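{- In Morpion Solitaire 5D, starting from the standard initial configuration, the number of moves in any play cannot exceed $132$.
   Context: Morpion Solitaire 5D is a one-player game on the integer lattice $\mathbb{Z}^2$. Initially there are 36 crosses, placed on the lattice points lying on the boundary of the 12-sided polygon (a "Greek cross") with consecutive vertices $(3,0),(6,0),(6,3),(9,3),(9,6),(6,6),(6,9),(3,9),(3,6),(0,6),(0,3),(3,3)$; each of its 12 edges contains exactly 4 lattice points. A move consists of: (1) placing a new cross on a lattice point that currently has no cross; (2) drawing a line, i.e. a segment covering exactly 5 consecutive lattice points in one of the four directions (horizontal, vertical, or one of the two diagonals), such that all 5 covered points carry crosses and one of them is the cross placed in step (1). In the 5D variant, a newly drawn line may not share any lattice point with a previously drawn line of the same direction. The game is a sequence of legal moves; its score is the number of moves. -}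

module Defs where

open import Data.Nat using (ℕ)
open import Data.Integer using (ℤ; +_; -[1+_]; _+_; _*_; _-_)
open import Data.Fin using (Fin; toℕ)
open import Data.Product using (_×_; _,_; ∃; ∃-syntax; proj₁; proj₂)
open import Data.Sum using (_⊎_)
open import Data.List using (List; []; _∷_; map)
open import Data.List.Membership.Propositional using (_∈_)
open import Relation.Binary.PropositionalEquality using (_≡_)
open import Relation.Nullary using (¬_)

Point : Set
Point = ℤ × ℤ

_·_ : ℤ → Point → Point
k · (x , y) = (k * x , k * y)

_⊕_ : Point → Point → Point
(a , b) ⊕ (c , d) = (a + c , b + d)

-- Initial configuration: lattice points on the boundary of the Greek cross
-- with consecutive vertices (3,0),(6,0),(6,3),(9,3),(9,6),(6,6),(6,9),
-- (3,9),(3,6),(0,6),(0,3),(3,3).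

vertex : Fin 12 → Point
vertex Fin.zero = (+ 3 , + 0)
vertex (Fin.suc Fin.zero) = (+ 6 , + 0)
vertex (Fin.suc (Fin.suc Fin.zero)) = (+ 6 , + 3)
vertex (Fin.suc (Fin.suc (Fin.suc Fin.zero))) = (+ 9 , + 3)
vertex (Fin.suc (Fin.suc (Fin.suc (Fin.suc Fin.zero)))) = (+ 9 , + 6)
vertex (Fin.suc (Fin.suc (Fin.suc (Fin.suc (Fin.suc Fin.zero))))) = (+ 6 , + 6)
vertex (Fin.suc (Fin.suc (Fin.suc (Fin.suc (Fin.suc (Fin.suc Fin.zero)))))) = (+ 6 , + 9)
vertex (Fin.suc (Fin.suc (Fin.suc (Fin.suc (Fin.suc (Fin.suc (Fin.suc Fin.zero))))))) = (+ 3 , + 9)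
vertex (Fin.suc (Fin.suc (Fin.suc (Fin.suc (Fin.suc (Fin.suc (Fin.suc (Fin.suc Fin.zero)))))))) = (+ 3 , + 6)
vertex (Fin.suc (Fin.suc (Fin.suc (Fin.suc (Fin.suc (Fin.suc (Fin.suc (Fin.suc (Fin.suc Fin.zero))))))))) = (+ 0 , + 6)
vertex (Fin.suc (Fin.suc (Fin.suc (Fin.suc (Fin.suc (Fin.suc (Fin.suc (Fin.suc (Fin.suc (Fin.suc Fin.zero)))))))))) = (+ 0 , + 3)
vertex (Fin.suc (Fin.suc (Fin.suc (Fin.suc (Fin.suc (Fin.suc (Fin.suc (Fin.suc (Fin.suc (Fin.suc (Fin.suc Fin.zero))))))))))) = (+ 3 , + 3)

nextVertex : Fin 12 → Point
nextVertex k = vertex (Data.Fin.fromℕ< {suc12 (toℕ k)} (lemma k))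
  where
    open import Data.Nat using (suc; _<_; _%_)
    suc12 : ℕ → ℕ
    suc12 n = suc n % 12
    lemma : (k : Fin 12) → suc12 (toℕ k) < 12
    lemma k = Data.Nat.DivMod.m%n<n (suc (toℕ k)) 12
      where import Data.Nat.DivMod

-- every edge has length 3 with 4 lattice points: vertex + t·(next − vertex)/3
-- for t ∈ {0,1,2,3}; we state it as  3·p = (3−t)·a + t·b.
OnEdge : Point → Point → Point → Set
OnEdge a b p = ∃[ t ] ((+ 3) · p ≡ ((+ 3 - + (toℕ {4} t)) · a) ⊕ ((+ (toℕ {4} t)) · b))

InitialCross : Point → Set
InitialCross p = ∃[ k ] OnEdge (vertex k) (nextVertex k) p

data Dir : Set where
  horiz vert diag anti : Dir

dirVec : Dir → Point
dirVec horiz = (+ 1 , + 0)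
dirVec vert  = (+ 0 , + 1)
dirVec diag  = (+ 1 , + 1)
dirVec anti  = (+ 1 , -[1+ 0 ])

record Line : Set where
  constructor line
  field
    start : Point
    dir   : Dir

Covers : Line → Point → Set
Covers (line s d) p = ∃[ i ] (p ≡ s ⊕ ((+ (toℕ {5} i)) · dirVec d))

record Move : Set where
  constructor move
  field
    cross   : Point
    drawn   : Line
open Move public

-- A history is a list of moves, most recent move FIRST.
History : Set
History = List Move

HasCross : History → Point → Set
HasCross ms p = InitialCross p ⊎ (p ∈ map cross ms)

record LegalMove (ms : History) (m : Move) : Set where
  field
    fresh     : ¬ HasCross ms (cross m)
    onLine    : Covers (drawn m) (cross m)
    allCrosses : ∀ p → Covers (drawn m) p → HasCross ms p ⊎ p ≡ cross m
    disjoint5D : ∀ m′ → m′ ∈ ms → Line.dir (drawn m′) ≡ Line.dir (drawn m) →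
                 ∀ p → ¬ (Covers (drawn m′) p × Covers (drawn m) p)

data Play : History → Set where
  start : Play []
  step  : ∀ {ms m} → Play ms → LegalMove ms m → Play (m ∷ ms)

{-# OPTIONS --safe #-}

-- In each direction the drawn lines are disjoint and cover 5 crosses apiece.
-- After n moves there are 36 + n crosses, so at most ⌊(36 + n) / 5⌋ lines have
-- been drawn in that direction, and n ≤ 4 ⌊(36 + n) / 5⌋. This fails at n = 133
-- (4 · 33 = 132), and a longer play would have passed through 133 moves.

module Submission where

open import Defs
open import Data.Nat using (ℕ; suc; _+_; _*_; _/_; _≤_; z≤n; s≤s)
open import Data.Nat.Properties
  using (+-mono-≤; +-suc; m≤n⇒m<n∨m≡n; 1+n≰n; module ≤-Reasoning)
open import Data.Nat.DivMod using (/-monoˡ-≤; m*n/n≡m)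
import Data.Integer as ℤ
import Data.Integer.Properties as ℤ
import Data.Integer.DivMod as ℤ using (_/_)
open import Data.Fin using (Fin; toℕ)
import Data.Fin.Properties as Fin
open import Data.Product using (_×_; _,_; proj₁; proj₂)
open import Data.Product.Properties using (≡-dec)
open import Data.Sum using (inj₁; inj₂; [_,_]′)
open import Data.List using (List; []; _∷_; _++_; length; map; concatMap; filter; tabulate; allFin)
open import Data.List.Properties using (length-++; length-map)
open import Data.List.Membership.Propositional using (_∈_; find)
open import Data.List.Membership.Propositional.Properties
  using (∈-∃++; ∈-++⁺ˡ; ∈-++⁺ʳ; ∈-++⁻; ∈-tabulate⁻; ∈-concatMap⁻; ∈-filter⁻)
open import Data.List.Relation.Binary.Disjoint.Propositional using (Disjoint)
open import Data.List.Relation.Binary.Subset.Propositional using (_⊆_)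
open import Data.List.Relation.Unary.All as All using (All)
import Data.List.Relation.Unary.All.Properties as All
open import Data.List.Relation.Unary.AllPairs as AllPairs using (AllPairs; []; _∷_)
import Data.List.Relation.Unary.AllPairs.Properties as AllPairs
open import Data.List.Relation.Unary.Any as Any using (Any; here; there; any?)
open import Data.List.Relation.Unary.Unique.Propositional using (Unique)
import Data.List.Relation.Unary.Unique.Propositional.Properties as Unique
open import Algebra.Bundles using (module AbelianGroup)
open import Algebra.Properties.Group using (∙-cancelˡ)
open import Function using (_∘_; _on_)
open import Relation.Binary.Definitions using (DecidableEquality)
open import Relation.Binary.PropositionalEquality
  using (_≡_; refl; sym; trans; cong; cong₂; subst)
open import Relation.Nullary using (¬_; yes; no; contradiction)
open import Relation.Nullary.Decidable using (toWitness)

-- Induction on `xs`: delete one occurrence of the head from `ys`. The tail still embeds in what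
-- remains, since uniqueness keeps the head out of the tail.
Unique-⊆⇒length≤ : ∀ {A : Set} {xs ys : List A} → Unique xs → xs ⊆ ys → length xs ≤ length ys
Unique-⊆⇒length≤ [] _ = z≤n
Unique-⊆⇒length≤ {xs = x ∷ xs} (x∉xs ∷ xs!) xs⊆ys with ∈-∃++ (xs⊆ys (here refl))
... | as , bs , refl = begin
  suc (length xs)               ≤⟨ s≤s (Unique-⊆⇒length≤ xs! xs⊆as++bs) ⟩
  suc (length (as ++ bs))       ≡⟨ cong suc (length-++ as) ⟩
  suc (length as + length bs)   ≡⟨ +-suc (length as) (length bs) ⟨
  length as + suc (length bs)   ≡⟨ length-++ as ⟨
  length (as ++ x ∷ bs)         ∎
  where
  open ≤-Reasoning
  xs⊆as++bs : xs ⊆ as ++ bs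
  xs⊆as++bs y∈xs with ∈-++⁻ as (xs⊆ys (there y∈xs))
  ... | inj₁ y∈as         = ∈-++⁺ˡ y∈as
  ... | inj₂ (here refl)  = contradiction refl (All.lookup x∉xs y∈xs)
  ... | inj₂ (there y∈bs) = ∈-++⁺ʳ as y∈bs

_≟ᵖ_ : DecidableEquality Point
_≟ᵖ_ = ≡-dec ℤ._≟_ ℤ._≟_

3·-injective : ∀ {p q} → (ℤ.+ 3) · p ≡ (ℤ.+ 3) · q → p ≡ q
3·-injective eq = cong₂ _,_ (ℤ.*-cancelˡ-≡ (ℤ.+ 3) _ _ (cong proj₁ eq))
                            (ℤ.*-cancelˡ-≡ (ℤ.+ 3) _ _ (cong proj₂ eq))

-- The right-hand side in `OnEdge`. Taking `t` in `ℕ` lets it serve both the listing with `Fin 3`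
-- and the check with `Fin 4`.
edgePoint×3 : Fin 12 → ℕ → Point
edgePoint×3 k t = ((ℤ.+ 3 ℤ.- ℤ.+ t) · vertex k) ⊕ ((ℤ.+ t) · nextVertex k)

-- Three points per edge: the fourth is the first point of the next edge.
initialCrosses : List Point
initialCrosses = concatMap (λ k → tabulate {n = 3} (third ∘ edgePoint×3 k ∘ toℕ)) (allFin 12)
  where
  third : Point → Point
  third (x , y) = x ℤ./ ℤ.+ 3 , y ℤ./ ℤ.+ 3

-- Decided by evaluation on all 12 · 4 pairs. This confirms that the edge ends `t = 3` are listed on
-- other edges and that the divisions in `initialCrosses` are exact.
edgePoints-listed : ∀ k (t : Fin 4) → Any (λ r → (ℤ.+ 3) · r ≡ edgePoint×3 k (toℕ t)) initialCrosses
edgePoints-listed = toWitness {a? = Fin.all? λ k → Fin.all? λ t →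
  any? (λ r → ((ℤ.+ 3) · r) ≟ᵖ edgePoint×3 k (toℕ t)) initialCrosses} _

InitialCross⇒∈ : ∀ {p} → InitialCross p → p ∈ initialCrosses
InitialCross⇒∈ (k , t , 3p≡e) =
  Any.map (λ 3r≡e → 3·-injective (trans 3p≡e (sym 3r≡e))) (edgePoints-listed k t)

crosses : History → List Point
crosses ms = initialCrosses ++ map cross ms

HasCross⇒∈ : ∀ ms {p} → HasCross ms p → p ∈ crosses ms
HasCross⇒∈ ms = [ ∈-++⁺ˡ ∘ InitialCross⇒∈ , ∈-++⁺ʳ initialCrosses ]′

_≟ᵈ_ : DecidableEquality Dir
horiz ≟ᵈ horiz = yes refl
horiz ≟ᵈ vert  = no λ ()
horiz ≟ᵈ diag  = no λ ()
horiz ≟ᵈ anti  = no λ ()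
vert  ≟ᵈ horiz = no λ ()
vert  ≟ᵈ vert  = yes refl
vert  ≟ᵈ diag  = no λ ()
vert  ≟ᵈ anti  = no λ ()
diag  ≟ᵈ horiz = no λ ()
diag  ≟ᵈ vert  = no λ ()
diag  ≟ᵈ diag  = yes refl
diag  ≟ᵈ anti  = no λ ()
anti  ≟ᵈ horiz = no λ ()
anti  ≟ᵈ vert  = no λ ()
anti  ≟ᵈ diag  = no λ ()
anti  ≟ᵈ anti  = yes refl

-- Every `dirVec` has a coordinate equal to 1, from which the multiplier is read off.
·-dirVec-injective : ∀ d {i j} → i · dirVec d ≡ j · dirVec d → i ≡ j
·-dirVec-injective horiz eq = ℤ.*-cancelʳ-≡ _ _ (ℤ.+ 1) (cong proj₁ eq)
·-dirVec-injective vert  eq = ℤ.*-cancelʳ-≡ _ _ (ℤ.+ 1) (cong proj₂ eq)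
·-dirVec-injective diag  eq = ℤ.*-cancelʳ-≡ _ _ (ℤ.+ 1) (cong proj₁ eq)
·-dirVec-injective anti  eq = ℤ.*-cancelʳ-≡ _ _ (ℤ.+ 1) (cong proj₁ eq)

⊕-cancelˡ : ∀ s {p q} → s ⊕ p ≡ s ⊕ q → p ≡ q
⊕-cancelˡ (a , b) eq = cong₂ _,_ (cancel a _ _ (cong proj₁ eq)) (cancel b _ _ (cong proj₂ eq))
  where cancel = ∙-cancelˡ (AbelianGroup.group ℤ.+-0-abelianGroup)

linePoints : Line → List Point
linePoints (line s d) = tabulate {n = 5} λ i → s ⊕ ((ℤ.+ (toℕ i)) · dirVec d)

∈-linePoints⁻ : ∀ l {p} → p ∈ linePoints l → Covers l p
∈-linePoints⁻ (line _ _) = ∈-tabulate⁻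

linePoints-unique : ∀ l → Unique (linePoints l)
linePoints-unique (line s d) = Unique.tabulate⁺
  (Fin.toℕ-injective ∘ ℤ.+-injective ∘ ·-dirVec-injective d ∘ ⊕-cancelˡ s)

inDirection : Dir → History → History
inDirection d = filter λ m → Line.dir (drawn m) ≟ᵈ d

coveredPoints : History → List Point
coveredPoints = concatMap (linePoints ∘ drawn)

length-coveredPoints : ∀ ms → length (coveredPoints ms) ≡ length ms * 5
length-coveredPoints []       = refl
length-coveredPoints (m ∷ ms) = cong (5 +_) (length-coveredPoints ms)

count : Dir → History → ℕ
count d ms = length (inDirection d ms)

count-total : ∀ ms → count horiz ms + count vert ms + (count diag ms + count anti ms) ≡ length ms
count-total [] = refl
count-total (move _ (line _ horiz) ∷ ms) = cong suc (count-total ms)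
count-total (move _ (line _ vert) ∷ ms) =
  trans (cong (_+ (count diag ms + count anti ms)) (+-suc (count horiz ms) _))
        (cong suc (count-total ms))
count-total (move _ (line _ diag) ∷ ms) =
  trans (+-suc (count horiz ms + count vert ms) _) (cong suc (count-total ms))
count-total (move _ (line _ anti) ∷ ms) =
  trans (cong (count horiz ms + count vert ms +_) (+-suc (count diag ms) _))
        (trans (+-suc (count horiz ms + count vert ms) _) (cong suc (count-total ms)))

-- Histories are listed most recent first, so in `AllPairs` the argument `m` is the later move and
-- `m′` the earlier one, as in `disjoint5D`.
Disjoint5D : Move → Move → Set
Disjoint5D m m′ = Line.dir (drawn m′) ≡ Line.dir (drawn m) →
                  ∀ p → ¬ (Covers (drawn m′) p × Covers (drawn m) p)

linePoints-disjoint : ∀ {d ms} → AllPairs Disjoint5D ms → All (λ m → Line.dir (drawn m) ≡ d) ms →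
                      AllPairs (Disjoint on (linePoints ∘ drawn)) ms
linePoints-disjoint []         All.[]         = []
linePoints-disjoint {ms = m ∷ _} (dj ∷ djs) (e All.∷ es) =
  All.zipWith (λ { {m′} (dis , e′) (p∈ , p∈′) → dis (trans e′ (sym e)) _
    (∈-linePoints⁻ (drawn m′) p∈′ , ∈-linePoints⁻ (drawn m) p∈) }) (dj , es)
  ∷ linePoints-disjoint djs es

play-disjoint : ∀ {ms} → Play ms → AllPairs Disjoint5D ms
play-disjoint start         = []
play-disjoint (step play l) = All.tabulate (LegalMove.disjoint5D l _) ∷ play-disjoint play

-- When a line is drawn, its points carry crosses, old or just placed, and later moves never remove
-- a cross.
play-covered : ∀ {ms m p} → Play ms → m ∈ ms → Covers (drawn m) p → HasCross ms p
play-covered (step play l) (here refl) c with LegalMove.allCrosses l _ c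
... | inj₁ (inj₁ i)  = inj₁ i
... | inj₁ (inj₂ p∈) = inj₂ (there p∈)
... | inj₂ p≡        = inj₂ (here p≡)
play-covered (step play l) (there m∈) c with play-covered play m∈ c
... | inj₁ i  = inj₁ i
... | inj₂ p∈ = inj₂ (there p∈)

module _ {ms : History} (play : Play ms) (d : Dir) where

  private
    dms = inDirection d ms

  -- No repetition within a line, because its 5 points differ, nor between two lines, because all of
  -- them have direction `d`.
  coveredPoints-unique : Unique (coveredPoints dms)
  coveredPoints-unique = Unique.concat⁺
    (All.map⁺ (All.universal (linePoints-unique ∘ drawn) dms))
    (AllPairs.map⁺ (linePoints-disjoint (AllPairs.filter⁺ _ (play-disjoint play)) (All.all-filter _ ms)))

  coveredPoints⊆crosses : coveredPoints dms ⊆ crosses ms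
  coveredPoints⊆crosses p∈ with find (∈-concatMap⁻ (linePoints ∘ drawn) p∈)
  ... | m , m∈ , p∈m =
    HasCross⇒∈ ms (play-covered play (proj₁ (∈-filter⁻ _ m∈)) (∈-linePoints⁻ (drawn m) p∈m))

  count≤ : count d ms ≤ (36 + length ms) / 5
  count≤ = begin
    count d ms                      ≡⟨ m*n/n≡m (length dms) 5 ⟨
    length dms * 5 / 5              ≡⟨ cong (_/ 5) (length-coveredPoints dms) ⟨
    length (coveredPoints dms) / 5
      ≤⟨ /-monoˡ-≤ 5 (Unique-⊆⇒length≤ coveredPoints-unique coveredPoints⊆crosses) ⟩
    -- The closed list `initialCrosses` evaluates to 12 · 3 = 36 entries.
    length (crosses ms) / 5         ≡⟨ cong (λ n → (36 + n) / 5) (length-map cross ms) ⟩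
    (36 + length ms) / 5            ∎
    where open ≤-Reasoning

length≤ : ∀ {ms} → Play ms → let q = (36 + length ms) / 5 in length ms ≤ q + q + (q + q)
length≤ {ms} play = begin
  length ms
    ≡⟨ count-total ms ⟨
  count horiz ms + count vert ms + (count diag ms + count anti ms)
    ≤⟨ +-mono-≤ (+-mono-≤ (bound horiz) (bound vert)) (+-mono-≤ (bound diag) (bound anti)) ⟩
  q + q + (q + q) ∎
  where
  open ≤-Reasoning
  q = (36 + length ms) / 5
  bound = count≤ play

theorem4 : ∀ (ms : History) → Play ms → length ms ≤ 132
theorem4 []       start              = z≤n
-- The inequality of `length≤` fails at 133 but holds again at 134, where 4 · 34 = 136. Hence the
-- induction along the play, which stops it at the step from 132 to 133.
theorem4 (m ∷ ms) play@(step play′ _) with m≤n⇒m<n∨m≡n (theorem4 ms play′)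
... | inj₁ n<132 = n<132
-- Here 37 + n is 36 + `suc n`. For n = 132 the quotient 169 / 5 is 33, so the bound reads 133 ≤
-- 132.
... | inj₂ n≡132 = contradiction
  (subst (λ n → let q = (37 + n) / 5 in suc n ≤ q + q + (q + q)) n≡132 (length≤ play)) 1+n≰n
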